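{- Let $\mathbf{L}\in\{DmbCciw,\,DmbCci,\,DbC,\,DCi\}$. For every $\Gamma\cup\{\varphi\}\subseteq For(\Sigma)$, if $\Gamma\vdash_{\mathbf{L}}\varphi$, then $\Gamma\vDash_{\mathbf{L}}\varphi$.
   Context: **Syntax.** $For(\Sigma)$ is the set of formulas generated from a denumerable set of propositional variables by the signature $\Sigma=\{\to,\neg,\lor,\land,\mathsf{O},\circ\}$ ($\neg,\mathsf{O},\circ$ unary; $\to,\lor,\land$ binary). **The logics.** $DmbC$ is the Hilbert calculus whose axiom schemas are those of $CPL^+$, the positive fragment of classical propositional logic in $\to,\land,\lor$ (for instance: $\alpha\to(\beta\to\alpha)$; $(\alpha\to(\beta\to\gamma))\to((\alpha\to\beta)\to(\alpha\to\gamma))$; $\alpha\to(\beta\to(\alpha\land\beta))$; $(\alpha\land\beta)\to\alpha$; $(\alpha\land\beta)\to\beta$; $\alpha\to(\alpha\lor\beta)$; $\beta\to(\alpha\lor\beta)$; $(\alpha\to\gamma)\to((\beta\to\gamma)\to((\alpha\lor\beta)\to\gamma))$; $\alpha\lor(\alpha\to\beta)$), plus (EM) $\alpha\lor\neg\alpha$; (bc) $\circ\alpha\to(\alpha\to(\neg\alpha\to\beta))$; ($\mathsf{O}$-K) $\mathsf{O}(\alpha\to\beta)\to(\mathsf{O}\alpha\to\mathsf{O}\beta)$; ($\mathsf{O}$-E) $\mathsf{O}\bot_\alpha\to\bot_\alpha$, where $\bot_\alpha:=(\alpha\land\neg\alpha)\land\circ\alpha$. The rules are Modus Ponens and $\mathsf{O}$-necessitation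 (from $\varphi$ infer $\mathsf{O}\varphi$). Consider the schemas (ciw) $\circ\alpha\lor(\alpha\land\neg\alpha)$; (ci) $\neg\circ\alpha\to(\alpha\land\neg\alpha)$; (cf) $\neg\neg\alpha\to\alpha$. Then $DmbCciw=DmbC+$(ciw); $DmbCci=DmbC+$(ci); $DbC=DmbC+$(cf); $DCi=DmbCci+$(cf). $\vdash_{\mathbf{L}}\varphi$ means that there is a finite derivation of $\varphi$ from axioms of $\mathbf{L}$ (no premises) using the rules. $\Gamma\vdash_{\mathbf{L}}\varphi$ means: either $\vdash_{\mathbf{L}}\varphi$, or there are $\gamma_1,\dots,\gamma_k\in\Gamma$ ($k\ge 1$ finite) with $\vdash_{\mathbf{L}}(\gamma_1\land\dots\land\gamma_k)\to\varphi$. **Semantics.** Let $A=\{T,t,F\}$ with $T=(1,0)$, $t=(1,1)$, $F=(0,1)$; for $a\in A$ write $a=(a_1,a_2)$. Designated values: $\mathcal{D}=\{T,t\}$. Let $\sqcap,\sqcup,\supset,{\sim}$ be the Boolean meet, join, implication and complement on $\{0,1\}$, and $\bigwedge$ the meet of a non-empty subset. For $a,b\in A$, $\emptyset\neq X\subseteq A$: - $a\,\tilde\land\,b=\{c\in A: c_1=a_1\sqcap b_1\}$; $a\,\tilde\lor\,b=\{c\in A: c_1=a_1\sqcup b_1\}$; $a\,\tilde\to\,b=\{c\in A: c_1=a_1\supset b_1\}$; - $\tilde\neg a=\{c\in A: c_1=a_2\}$; $\tilde\neg_1 a=\{c\in A: c_1=a_2\text{ and }c_2\le a_1\}$; - $\tilde\circ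 a=\{c\in A: c_1\le{\sim}(a_1\sqcap a_2)\}$; $\tilde\circ_1 a=\{c\in A: c_1={\sim}(a_1\sqcap a_2)\}$; $\tilde\circ_2 a=\{({\sim}(a_1\sqcap a_2),\,a_1\sqcap a_2)\}$; - $\tilde{\mathsf{O}}(X)=\{c\in A: c_1=\bigwedge\{x_1:x\in X\}\}$. For each $\mathbf{L}$ the pair of multioperators interpreting $(\neg,\circ)$, denoted $(\tilde\neg^{\mathbf{L}},\tilde\circ^{\mathbf{L}})$, is: $(\tilde\neg,\tilde\circ_1)$ for $DmbCciw$; $(\tilde\neg,\tilde\circ_2)$ for $DmbCci$; $(\tilde\neg_1,\tilde\circ)$ for $DbC$; $(\tilde\neg_1,\tilde\circ_2)$ for $DCi$. A swap Kripke model for $\mathbf{L}$ is a triple $\langle W,R,\{v_w\}_{w\in W}\rangle$ where $W\ne\emptyset$, $R\subseteq W^2$ is serial (every $w$ has some $w'$ with $wRw'$), and each $v_w:For(\Sigma)\to A$ satisfies, for all $\alpha,\beta$: $v_w(\alpha\#\beta)\in v_w(\alpha)\,\tilde\#\,v_w(\beta)$ for $\#\in\{\land,\lor,\to\}$; $v_w(\neg\alpha)\in\tilde\neg^{\mathbf{L}} v_w(\alpha)$; $v_w(\circ\alpha)\in\tilde\circ^{\mathbf{L}} v_w(\alpha)$; $v_w(\mathsf{O}\alpha)\in\tilde{\mathsf{O}}(\{v_{w'}(\alpha): wRw'\})$. $\mathcal{M},w\vDash\alpha$ means $v_w(\alpha)\in\mathcal{D}$; $\mathcal{M},w\vDash\Gamma$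 means $\mathcal{M},w\vDash\gamma$ for all $\gamma\in\Gamma$. $\Gamma\vDash_{\mathbf{L}}\alpha$ means: for every swap Kripke model $\mathcal{M}$ for $\mathbf{L}$ and every world $w$ of it, $\mathcal{M},w\vDash\Gamma$ implies $\mathcal{M},w\vDash\alpha$. -}

module Defs where

open import Data.Bool.Base using (Bool; true; false; _≤_)
  renaming (_∧_ to _⊓_; _∨_ to _⊔_; not to ∼_)
open import Data.List.NonEmpty.Base using (List⁺; foldr₁)
open import Data.List.NonEmpty.Relation.Unary.All using (All)
open import Data.Nat.Base using (ℕ)
open import Data.Product.Base using (_×_; _,_; proj₁; proj₂; ∃-syntax; Σ-syntax)
open import Data.Sum.Base using (_⊎_)
open import Level using (Level; 0ℓ) renaming (suc to ℓsuc; _⊔_ to _⊔ℓ_)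
open import Relation.Binary.Core using (Rel)
open import Relation.Binary.PropositionalEquality.Core using (_≡_)
open import Relation.Unary using (Pred; _∈_; _∪_)

infixr 5 _⇒_
infixr 6 _∨_
infixr 7 _∧_
infix  9 ¬_ O_ ∘_

data Formula : Set where
  var         : ℕ → Formula
  _⇒_ _∨_ _∧_ : Formula → Formula → Formula
  ¬_ O_ ∘_    : Formula → Formula

⊥[_] : Formula → Formula
⊥[ α ] = (α ∧ ¬ α) ∧ ∘ α

data CPL⁺ : Pred Formula 0ℓ where
  ⇒-K  : ∀ α β   → CPL⁺ (α ⇒ (β ⇒ α))
  ⇒-S  : ∀ α β γ → CPL⁺ ((α ⇒ (β ⇒ γ)) ⇒ ((α ⇒ β) ⇒ (α ⇒ γ)))
  ∧-I  : ∀ α β   → CPL⁺ (α ⇒ (β ⇒ (α ∧ β)))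
  ∧-E₁ : ∀ α β   → CPL⁺ ((α ∧ β) ⇒ α)
  ∧-E₂ : ∀ α β   → CPL⁺ ((α ∧ β) ⇒ β)
  ∨-I₁ : ∀ α β   → CPL⁺ (α ⇒ (α ∨ β))
  ∨-I₂ : ∀ α β   → CPL⁺ (β ⇒ (α ∨ β))
  ∨-E  : ∀ α β γ → CPL⁺ ((α ⇒ γ) ⇒ ((β ⇒ γ) ⇒ ((α ∨ β) ⇒ γ)))
  ∨-⇒  : ∀ α β   → CPL⁺ (α ∨ (α ⇒ β))

data DmbC : Pred Formula 0ℓ where
  cpl⁺ : ∀ {φ} → CPL⁺ φ → DmbC φ
  EM   : ∀ α   → DmbC (α ∨ ¬ α)
  bc   : ∀ α β → DmbC (∘ α ⇒ (α ⇒ (¬ α ⇒ β)))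
  O-K  : ∀ α β → DmbC (O (α ⇒ β) ⇒ (O α ⇒ O β))
  O-E  : ∀ α   → DmbC (O ⊥[ α ] ⇒ ⊥[ α ])

data Ciw : Pred Formula 0ℓ where
  ciw : ∀ α → Ciw (∘ α ∨ (α ∧ ¬ α))

data Ci : Pred Formula 0ℓ where
  ci : ∀ α → Ci (¬ ∘ α ⇒ (α ∧ ¬ α))

data Cf : Pred Formula 0ℓ where
  cf : ∀ α → Cf (¬ ¬ α ⇒ α)

data Logic : Set where
  DmbCciw DmbCci DbC DCi : Logic

Axiom : Logic → Pred Formula 0ℓ
Axiom DmbCciw = DmbC ∪ Ciw
Axiom DmbCci  = DmbC ∪ Ci
Axiom DbC     = DmbC ∪ Cf
Axiom DCi     = Axiom DmbCci ∪ Cf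

infix 3 ⊢[_]_ _⊢[_]_

data ⊢[_]_ (L : Logic) : Pred Formula 0ℓ where
  axiom : ∀ {φ}   → φ ∈ Axiom L → ⊢[ L ] φ
  MP    : ∀ {φ ψ} → ⊢[ L ] φ ⇒ ψ → ⊢[ L ] φ → ⊢[ L ] ψ
  O-nec : ∀ {φ}   → ⊢[ L ] φ → ⊢[ L ] O φ

-- Premises enter only through a finite conjunction, so O-nec never applies to
-- them.
_⊢[_]_ : ∀ {ℓ} → Pred Formula ℓ → Logic → Formula → Set ℓ
Γ ⊢[ L ] φ =
  ⊢[ L ] φ ⊎ (Σ[ γs ∈ List⁺ Formula ] All (_∈ Γ) γs × ⊢[ L ] foldr₁ _∧_ γs ⇒ φ)

data A : Set where
  T t F : A

coords : A → Bool × Bool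
coords T = true  , false
coords t = true  , true
coords F = false , true

π₁ π₂ : A → Bool
π₁ a = proj₁ (coords a)
π₂ a = proj₂ (coords a)

Designated : Pred A 0ℓ
Designated a = a ≡ T ⊎ a ≡ t

infixr 5 _⊃_

_⊃_ : Bool → Bool → Bool
x ⊃ y = ∼ x ⊔ y

-- The meet of an arbitrary set of booleans is not computable, so "b = ⋀ X" is
-- expressed as the relation "b is the greatest lower bound of X".
IsMeet : ∀ {ℓ} → Pred Bool ℓ → Pred Bool ℓ
IsMeet X b = (∀ {x} → x ∈ X → b ≤ x) × (∀ c → (∀ {x} → x ∈ X → c ≤ x) → c ≤ b)

-- A multioperator returns the set of admissible values.

_⟦∧⟧_ _⟦∨⟧_ _⟦⇒⟧_ : A → A → Pred A 0ℓ
(a ⟦∧⟧ b) c = π₁ c ≡ π₁ a ⊓ π₁ b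
(a ⟦∨⟧ b) c = π₁ c ≡ π₁ a ⊔ π₁ b
(a ⟦⇒⟧ b) c = π₁ c ≡ π₁ a ⊃ π₁ b

⟦¬⟧ ⟦¬⟧₁ : A → Pred A 0ℓ
⟦¬⟧  a c = π₁ c ≡ π₂ a
⟦¬⟧₁ a c = π₁ c ≡ π₂ a × π₂ c ≤ π₁ a

⟦∘⟧ ⟦∘⟧₁ ⟦∘⟧₂ : A → Pred A 0ℓ
⟦∘⟧  a c = π₁ c ≤ ∼ (π₁ a ⊓ π₂ a)
⟦∘⟧₁ a c = π₁ c ≡ ∼ (π₁ a ⊓ π₂ a)
⟦∘⟧₂ a c = coords c ≡ (∼ (π₁ a ⊓ π₂ a) , π₁ a ⊓ π₂ a)

-- Only used on non-empty X: the accessibility relation of a model is serial.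
⟦O⟧ : ∀ {ℓ} → Pred A ℓ → Pred A ℓ
⟦O⟧ X c = IsMeet (λ b → ∃[ x ] x ∈ X × b ≡ π₁ x) (π₁ c)

neg cons : Logic → A → Pred A 0ℓ
neg DmbCciw = ⟦¬⟧
neg DmbCci  = ⟦¬⟧
neg DbC     = ⟦¬⟧₁
neg DCi     = ⟦¬⟧₁
cons DmbCciw = ⟦∘⟧₁
cons DmbCci  = ⟦∘⟧₂
cons DbC     = ⟦∘⟧
cons DCi     = ⟦∘⟧₂

record SwapKripkeModel (L : Logic) (w r : Level) : Set (ℓsuc (w ⊔ℓ r)) where
  field
    W         : Set w
    inhabited : W
    R         : Rel W r
    serial    : ∀ u → ∃[ u′ ] R u u′
    v         : W → Formula → A
    v-∧       : ∀ u α β → v u (α ∧ β) ∈ (v u α ⟦∧⟧ v u β)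
    v-∨       : ∀ u α β → v u (α ∨ β) ∈ (v u α ⟦∨⟧ v u β)
    v-⇒       : ∀ u α β → v u (α ⇒ β) ∈ (v u α ⟦⇒⟧ v u β)
    v-¬       : ∀ u α → v u (¬ α) ∈ neg L (v u α)
    v-∘       : ∀ u α → v u (∘ α) ∈ cons L (v u α)
    v-O       : ∀ u α → v u (O α) ∈ ⟦O⟧ (λ a → ∃[ u′ ] R u u′ × a ≡ v u′ α)

infix 3 _,_⊨_ _,_⊨*_

_,_⊨_ : ∀ {L w r} (M : SwapKripkeModel L w r) →
        SwapKripkeModel.W M → Formula → Set
M , u ⊨ α = Designated (SwapKripkeModel.v M u α)

_,_⊨*_ : ∀ {L w r ℓ} (M : SwapKripkeModel L w r) →
         SwapKripkeModel.W M → Pred Formula ℓ → Set ℓ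
M , u ⊨* Γ = ∀ {γ} → γ ∈ Γ → M , u ⊨ γ

-- The levels w and r bound the universes of the models quantified over.
Consequence : ∀ w r {ℓ} → Logic → Pred Formula ℓ → Formula → Set (ℓsuc (w ⊔ℓ r) ⊔ℓ ℓ)
Consequence w r L Γ φ =
  ∀ (M : SwapKripkeModel L w r) (u : SwapKripkeModel.W M) → M , u ⊨* Γ → M , u ⊨ φ

{-# OPTIONS --safe #-}
-- Read u ⊩ α as "the first coordinate of v u α is 1".  The multioperators fix
-- first coordinates so that ⊩ is Tarskian on ∧, ∨, ⇒ and Kripkean on O, while
-- ⊩ for ¬ α reads off the second coordinate of α.  The axioms then hold
-- at every world, and the rules preserve truth at all worlds.
module Submission where

open import Defs
open import Data.Bool.Base using (true; false; _≤_; b≤b)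
  renaming (_∧_ to _⊓_; _∨_ to _⊔_; not to ∼_)
open import Data.Empty using (⊥; ⊥-elim)
open import Data.List.NonEmpty.Base using (foldr₁; _∷_)
open import Data.List.NonEmpty.Relation.Unary.All using (_∷_)
import Data.List.Relation.Unary.All as List
open import Data.Product.Base using (_×_; _,_; proj₁; proj₂)
open import Data.Sum.Base using (_⊎_; inj₁; inj₂; [_,_]; map₂)
open import Level using (Level)
open import Relation.Binary.PropositionalEquality
  using (_≡_; refl; sym; trans; cong; subst)
open import Relation.Unary using (Pred; _∈_)

true≤⇒≡true : ∀ {x} → true ≤ x → x ≡ true
true≤⇒≡true b≤b = refl

⊓-true⁺ : ∀ {x y} → x ≡ true → y ≡ true → x ⊓ y ≡ true
⊓-true⁺ refl refl = refl

⊓-true⁻ : ∀ {x y} → x ⊓ y ≡ true → x ≡ true × y ≡ true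
⊓-true⁻ {true} {true} refl = refl , refl

⊔-true⁺ : ∀ {x y} → x ≡ true ⊎ y ≡ true → x ⊔ y ≡ true
⊔-true⁺         (inj₁ refl) = refl
⊔-true⁺ {false} (inj₂ refl) = refl
⊔-true⁺ {true}  (inj₂ refl) = refl

⊔-true⁻ : ∀ {x y} → x ⊔ y ≡ true → x ≡ true ⊎ y ≡ true
⊔-true⁻ {true}  _ = inj₁ refl
⊔-true⁻ {false} p = inj₂ p

⊃-true⁺ : ∀ {x y} → (x ≡ true → y ≡ true) → x ⊃ y ≡ true
⊃-true⁺ {true}  f = f refl
⊃-true⁺ {false} f = refl

⊃-true⁻ : ∀ {x y} → x ⊃ y ≡ true → x ≡ true → y ≡ true
⊃-true⁻ p refl = p

true-or-∼true : ∀ x → x ≡ true ⊎ ∼ x ≡ true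
true-or-∼true true  = inj₁ refl
true-or-∼true false = inj₂ refl

designated⇒π₁ : ∀ {a} → Designated a → π₁ a ≡ true
designated⇒π₁ (inj₁ refl) = refl
designated⇒π₁ (inj₂ refl) = refl

π₁⇒designated : ∀ {a} → π₁ a ≡ true → Designated a
π₁⇒designated {T} _ = inj₁ refl
π₁⇒designated {t} _ = inj₂ refl

-- The pair (0,0) is not among the values in `A`; this is what validates `EM`.
π₁-or-π₂ : ∀ a → π₁ a ≡ true ⊎ π₂ a ≡ true
π₁-or-π₂ T = inj₁ refl
π₁-or-π₂ t = inj₁ refl
π₁-or-π₂ F = inj₂ refl

-- `⟦¬⟧₁` only adds a bound on the second coordinate, so all four logics share one reading of
-- negation.
neg-π₁ : ∀ L {a c} → c ∈ neg L a → π₁ c ≡ π₂ a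
neg-π₁ DmbCciw = λ p → p
neg-π₁ DmbCci  = λ p → p
neg-π₁ DbC     = proj₁
neg-π₁ DCi     = proj₁

-- Both coordinates are 1 only at `t`, and there each of the three multioperators for `∘` forces
-- first coordinate 0. Both `bc` and `O-E` rest on this.
cons-consistent : ∀ L {a c} → c ∈ cons L a →
                  π₁ c ≡ true → π₁ a ≡ true → π₂ a ≡ true → ⊥
cons-consistent L {t} c∈ p refl refl with true≤⇒≡true (subst (_≤ false) p (bound L c∈))
  where
  bound : ∀ L {c} → c ∈ cons L t → π₁ c ≤ false
  bound DmbCciw p = subst (_≤ false) (sym p) b≤b
  bound DmbCci  p = subst (_≤ false) (sym (cong proj₁ p)) b≤b
  bound DbC     p = p
  bound DCi     p = subst (_≤ false) (sym (cong proj₁ p)) b≤b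
... | ()

-- The chain is c₁ = b₂ ≤ a₁: the equation comes from the outer negation, the bound from the inner
-- one.
⟦¬⟧₁-double-neg : ∀ a b c → b ∈ ⟦¬⟧₁ a → c ∈ ⟦¬⟧₁ b → π₁ c ≡ true → π₁ a ≡ true
⟦¬⟧₁-double-neg _ _ _ (_ , b₂≤a₁) (c₁≡b₂ , _) p =
  true≤⇒≡true (subst (_≤ _) (trans (sym c₁≡b₂) p) b₂≤a₁)

module Truth {L w r} (M : SwapKripkeModel L w r) where
  open SwapKripkeModel M

  infix 3 _⊩_

  _⊩_ : W → Formula → Set
  u ⊩ α = π₁ (v u α) ≡ true

  module _ {u : W} where

    ⇒⁺ : ∀ {α β} → (u ⊩ α → u ⊩ β) → u ⊩ α ⇒ β
    ⇒⁺ f = trans (v-⇒ u _ _) (⊃-true⁺ f)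

    ⇒⁻ : ∀ {α β} → u ⊩ α ⇒ β → u ⊩ α → u ⊩ β
    ⇒⁻ p = ⊃-true⁻ (trans (sym (v-⇒ u _ _)) p)

    ∧⁺ : ∀ {α β} → u ⊩ α → u ⊩ β → u ⊩ α ∧ β
    ∧⁺ p q = trans (v-∧ u _ _) (⊓-true⁺ p q)

    ∧⁻ : ∀ {α β} → u ⊩ α ∧ β → u ⊩ α × u ⊩ β
    ∧⁻ p = ⊓-true⁻ (trans (sym (v-∧ u _ _)) p)

    ∨⁺ : ∀ {α β} → u ⊩ α ⊎ u ⊩ β → u ⊩ α ∨ β
    ∨⁺ p = trans (v-∨ u _ _) (⊔-true⁺ p)

    ∨⁻ : ∀ {α β} → u ⊩ α ∨ β → u ⊩ α ⊎ u ⊩ β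
    ∨⁻ p = ⊔-true⁻ (trans (sym (v-∨ u _ _)) p)

    ¬⁺ : ∀ {α} → π₂ (v u α) ≡ true → u ⊩ ¬ α
    ¬⁺ p = trans (neg-π₁ L (v-¬ u _)) p

    ¬⁻ : ∀ {α} → u ⊩ ¬ α → π₂ (v u α) ≡ true
    ¬⁻ p = trans (sym (neg-π₁ L (v-¬ u _))) p

    π₁⊓π₂⇒∧¬ : ∀ {α} → π₁ (v u α) ⊓ π₂ (v u α) ≡ true → u ⊩ α ∧ ¬ α
    π₁⊓π₂⇒∧¬ p = let p₁ , p₂ = ⊓-true⁻ p in ∧⁺ p₁ (¬⁺ p₂)

    ∘-explosive : ∀ {α} → u ⊩ ∘ α → u ⊩ α → u ⊩ ¬ α → ⊥
    ∘-explosive p q s = cons-consistent L (v-∘ u _) p q (¬⁻ s)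

    O⁺ : ∀ {α} → (∀ {u′} → R u u′ → u′ ⊩ α) → u ⊩ O α
    -- `true` is a lower bound of the values of `α` at the successors, hence lies below their
    -- greatest lower bound.
    O⁺ {α} f = true≤⇒≡true (proj₂ (v-O u α) true lower)
      where
      lower : ∀ {x} → _ → true ≤ x
      lower (_ , (u′ , Ruu′ , refl) , refl) = subst (true ≤_) (sym (f Ruu′)) b≤b

    O⁻ : ∀ {α u′} → u ⊩ O α → R u u′ → u′ ⊩ α
    O⁻ {α} p Ruu′ =
      true≤⇒≡true (subst (_≤ _) p (proj₁ (v-O u α) (_ , (_ , Ruu′ , refl) , refl)))

  ⊥-unsatisfiable : ∀ {u α} → u ⊩ ⊥[ α ] → ⊥
  ⊥-unsatisfiable p =
    let q , s = ∧⁻ p ; q₁ , q₂ = ∧⁻ q in ∘-explosive s q₁ q₂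

  CPL⁺-sound : ∀ {φ} → CPL⁺ φ → ∀ u → u ⊩ φ
  CPL⁺-sound (⇒-K α β)    u = ⇒⁺ λ p → ⇒⁺ λ _ → p
  CPL⁺-sound (⇒-S α β γ)  u = ⇒⁺ λ p → ⇒⁺ λ q → ⇒⁺ λ s → ⇒⁻ (⇒⁻ p s) (⇒⁻ q s)
  CPL⁺-sound (∧-I α β)    u = ⇒⁺ λ p → ⇒⁺ λ q → ∧⁺ p q
  CPL⁺-sound (∧-E₁ α β)   u = ⇒⁺ λ p → proj₁ (∧⁻ p)
  CPL⁺-sound (∧-E₂ α β)   u = ⇒⁺ λ p → proj₂ (∧⁻ p)
  CPL⁺-sound (∨-I₁ α β)   u = ⇒⁺ λ p → ∨⁺ (inj₁ p)
  CPL⁺-sound (∨-I₂ α β)   u = ⇒⁺ λ p → ∨⁺ (inj₂ p)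
  CPL⁺-sound (∨-E α β γ)  u =
    ⇒⁺ λ p → ⇒⁺ λ q → ⇒⁺ λ s → [ ⇒⁻ p , ⇒⁻ q ] (∨⁻ s)
  CPL⁺-sound (∨-⇒ α β)    u with true-or-∼true (π₁ (v u α))
  ... | inj₁ p = ∨⁺ (inj₁ p)
  -- Here `α` has first coordinate 0, which makes `α ⇒ β` true whatever `β` is.
  ... | inj₂ p = ∨⁺ (inj₂ (trans (v-⇒ u α β) (⊔-true⁺ (inj₁ p))))

  DmbC-sound : ∀ {φ} → DmbC φ → ∀ u → u ⊩ φ
  DmbC-sound (cpl⁺ ax) u = CPL⁺-sound ax u
  DmbC-sound (EM α)    u = ∨⁺ (map₂ ¬⁺ (π₁-or-π₂ (v u α)))
  DmbC-sound (bc α β)  u = ⇒⁺ λ p → ⇒⁺ λ q → ⇒⁺ λ s → ⊥-elim (∘-explosive p q s)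
  DmbC-sound (O-K α β) u = ⇒⁺ λ p → ⇒⁺ λ q → O⁺ λ Ruu′ → ⇒⁻ (O⁻ p Ruu′) (O⁻ q Ruu′)
  -- Seriality supplies a successor, and `⊥[ α ]` would have to hold there.
  DmbC-sound (O-E α)   u = ⇒⁺ λ p → ⊥-elim (⊥-unsatisfiable (O⁻ p (proj₂ (serial u))))

  -- `L` is a variable here, so `cons L` does not reduce; `h` fixes the multioperator that validates
  -- the axiom. `ci-sound` and `cf-sound` use the same device.
  ciw-sound : (∀ u α → v u (∘ α) ∈ ⟦∘⟧₁ (v u α)) → ∀ {φ} → Ciw φ → ∀ u → u ⊩ φ
  ciw-sound h (ciw α) u with true-or-∼true (π₁ (v u α) ⊓ π₂ (v u α))
  ... | inj₁ p = ∨⁺ (inj₂ (π₁⊓π₂⇒∧¬ p))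
  ... | inj₂ p = ∨⁺ (inj₁ (trans (h u α) p))

  ci-sound : (∀ u α → v u (∘ α) ∈ ⟦∘⟧₂ (v u α)) → ∀ {φ} → Ci φ → ∀ u → u ⊩ φ
  -- `¬ ∘ α` reads off the second coordinate of `∘ α`, which `⟦∘⟧₂` sets to the meet of the two
  -- coordinates of `α`.
  ci-sound h (ci α) u = ⇒⁺ λ p → π₁⊓π₂⇒∧¬ (trans (sym (cong proj₂ (h u α))) (¬⁻ p))

  cf-sound : (∀ u α → v u (¬ α) ∈ ⟦¬⟧₁ (v u α)) → ∀ {φ} → Cf φ → ∀ u → u ⊩ φ
  cf-sound h (cf α) u = ⇒⁺ (⟦¬⟧₁-double-neg (v u α) (v u (¬ α)) (v u (¬ ¬ α)) (h u α) (h u (¬ α)))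

  -- Keeping the head apart lets the induction run on the tail, with the next premise becoming the
  -- new head.
  foldr₁-∧⁺ : ∀ {u ℓ} {Γ : Pred Formula ℓ} → (∀ {γ} → γ ∈ Γ → u ⊩ γ) →
              ∀ {γ γs} → γ ∈ Γ → List.All (_∈ Γ) γs → u ⊩ foldr₁ _∧_ (γ ∷ γs)
  foldr₁-∧⁺ h p List.[]       = h p
  foldr₁-∧⁺ h p (q List.∷ qs) = ∧⁺ (h p) (foldr₁-∧⁺ h q qs)

open Truth using (DmbC-sound; ciw-sound; ci-sound; cf-sound; ⇒⁻; O⁺; foldr₁-∧⁺)

-- Once `L` is a concrete logic, `neg L` and `cons L` reduce, and the model's own fields serve as
-- the hypotheses `h`.
axiom-sound : ∀ L {w r φ} (M : SwapKripkeModel L w r) → φ ∈ Axiom L →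
              ∀ u → Truth._⊩_ M u φ
axiom-sound DmbCciw M = [ DmbC-sound M , ciw-sound M (SwapKripkeModel.v-∘ M) ]
axiom-sound DmbCci  M = [ DmbC-sound M , ci-sound M (SwapKripkeModel.v-∘ M) ]
axiom-sound DbC     M = [ DmbC-sound M , cf-sound M (SwapKripkeModel.v-¬ M) ]
axiom-sound DCi     M =
  [ [ DmbC-sound M , ci-sound M (SwapKripkeModel.v-∘ M) ] , cf-sound M (SwapKripkeModel.v-¬ M) ]

⊢-sound : ∀ {L w r φ} (M : SwapKripkeModel L w r) → ⊢[ L ] φ → ∀ u → Truth._⊩_ M u φ
⊢-sound M (axiom ax) u = axiom-sound _ M ax u
⊢-sound M (MP d e)   u = ⇒⁻ M (⊢-sound M d u) (⊢-sound M e u)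
-- The induction hypothesis covers every world, in particular each successor of `u`.
⊢-sound M (O-nec d)  u = O⁺ M λ {u′} _ → ⊢-sound M d u′

theorem3p9 : ∀ {ℓ w r : Level} (L : Logic) (Γ : Pred Formula ℓ) (φ : Formula) →
    Γ ⊢[ L ] φ → Consequence w r L Γ φ
theorem3p9 L Γ φ (inj₁ d) M u _ = π₁⇒designated (⊢-sound M d u)
-- The derived implication holds at every world; the premises are assumed at `u`, so it is detached
-- there.
theorem3p9 L Γ φ (inj₂ (_ , p ∷ ps , d)) M u u⊨Γ =
  π₁⇒designated (⇒⁻ M (⊢-sound M d u)
    (foldr₁-∧⁺ M (λ γ∈Γ → designated⇒π₁ (u⊨Γ γ∈Γ)) p ps))
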